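{- There exists an outerplanar graph that is not $(\frac{5}{2},1)^*$-colorable.
   Context: Graphs are finite, undirected and simple. An outerplanar graph is a graph with a planar drawing for which all vertices belong to the outer face of the drawing. For a positive integer $k$ and $i,j\in\{0,1,\dots,k-1\}$, the circular distance is $|i-j|_k=\min\{|i-j|,\,k-|i-j|\}$. For a nonnegative integer $t$, a $(\frac{k}{2},t)^*$-coloring of a graph $G$ is a mapping $f:V(G)\to\{0,1,\dots,k-1\}$ such that adjacent vertices receive different integers and, for each vertex $u$, the number of neighbors $v$ of $u$ with $|f(u)-f(v)|_k=1$ is at most $t$. $G$ is $(\frac{k}{2},t)^*$-colorable if it has such a coloring. -}

module Defs where

open import Data.Fin using (Fin; toℕ) renaming (_<_ to _<ᶠ_)
open import Data.List using (List; []; _∷_; _∷ʳ_; length; filter; allFin)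
open import Data.Nat as ℕ using (ℕ; _⊓_; _∸_)
open import Data.Product using (Σ-syntax; ∃-syntax; _×_; _,_; proj₁; proj₂)
open import Data.Rational using (ℚ; 0ℚ; 1ℚ; _+_; _-_; _*_; _≤_; _<_; ∣_∣)
open import Data.Sum using (_⊎_)
open import Data.Unit using (⊤)
open import Function.Definitions using (Injective)
open import Level using (0ℓ)
open import Relation.Binary using (Rel; Symmetric; Irreflexive; Decidable)
open import Relation.Binary.Construct.Closure.ReflexiveTransitive using (Star)
open import Relation.Binary.PropositionalEquality using (_≡_; _≢_)
open import Relation.Nullary using (¬_)
open import Relation.Nullary.Decidable using (_×-dec_)

record Graph : Set₁ where
  field
    order  : ℕ
    Adj    : Rel (Fin order) 0ℓ
    adj?   : Decidable Adj
    sym    : Symmetric Adj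
    irrefl : Irreflexive _≡_ Adj

  Vertex : Set
  Vertex = Fin order

------------------------------------------------------------------------
-- Defective circular colourings

circularDistance : ∀ {k} → Fin k → Fin k → ℕ
circularDistance {k} i j = d ⊓ (k ∸ d)
  where d = ℕ.∣ toℕ i - toℕ j ∣

module _ (G : Graph) where
  open Graph G

  closeNeighbours : ∀ {k} → (Vertex → Fin k) → Vertex → List Vertex
  closeNeighbours f u =
    filter (λ v → adj? u v ×-dec (circularDistance (f u) (f v) ℕ.≟ 1))
           (allFin order)

  record IsColoring (k t : ℕ) (f : Vertex → Fin k) : Set where
    field
      proper    : ∀ {u v} → Adj u v → f u ≢ f v
      defective : ∀ u → length (closeNeighbours f u) ℕ.≤ t

  -- (k/2 , t)*-colorability; the argument k is the numerator.
  Colorable : (k t : ℕ) → Set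
  Colorable k t = ∃[ f ] IsColoring k t f

------------------------------------------------------------------------
-- Polygonal curves in the plane
--
-- Curves are polygonal with rational corners, and the plane is ℚ².  Two
-- segments with rational endpoints that meet in ℝ² also meet in ℚ², so
-- disjointness, and membership in a face, mean the same over ℚ as over ℝ.
-- Every planar drawing of a finite graph in ℝ² can be redrawn with such
-- curves, keeping the vertices that lie on each face.

Point : Set
Point = ℚ × ℚ

OnSegment : Point → Point → Point → Set
OnSegment (x₀ , y₀) (x₁ , y₁) (x , y) =
  ∃[ t ] 0ℚ ≤ t × t ≤ 1ℚ
       × x ≡ (1ℚ - t) * x₀ + t * x₁
       × y ≡ (1ℚ - t) * y₀ + t * y₁

-- The polygonal curve starting at p and running through the listed points.
OnPolyline : Point → List Point → Point → Set
OnPolyline p []       x = x ≡ p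
OnPolyline p (q ∷ qs) x = OnSegment p q x ⊎ OnPolyline q qs x

-- No self-intersections: each segment is nondegenerate and meets the
-- remainder of the curve only in the corner where that remainder starts.
SimplePolyline : Point → List Point → Set
SimplePolyline p []       = ⊤
SimplePolyline p (q ∷ qs) =
    p ≢ q
  × (∀ x → OnSegment p q x → OnPolyline q qs x → x ≡ q)
  × SimplePolyline q qs

------------------------------------------------------------------------
-- Planar drawings and outerplanarity

-- Each undirected edge is represented once, by its endpoints in increasing
-- order.
record Edge (G : Graph) : Set where
  constructor edge
  open Graph G
  field
    src tgt : Vertex
    ordered : src <ᶠ tgt
    adj     : Adj src tgt

record PlanarDrawing (G : Graph) : Set where
  open Graph G
  open Edge
  field
    pos   : Vertex → Point
    -- The interior corners of the curve from src to tgt; [] is a straight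
    -- segment.  They depend on the endpoints only, not on the adjacency proof.
    bends : Vertex → Vertex → List Point

  OnEdge : Edge G → Point → Set
  OnEdge e = OnPolyline (pos (src e)) (bends (src e) (tgt e) ∷ʳ pos (tgt e))

  field
    pos-injective : Injective _≡_ _≡_ pos
    edge-simple   : ∀ (e : Edge G) →
      SimplePolyline (pos (src e)) (bends (src e) (tgt e) ∷ʳ pos (tgt e))
    vertex-edge   : ∀ (w : Vertex) (e : Edge G) → OnEdge e (pos w) →
      w ≡ src e ⊎ w ≡ tgt e
    -- Together with vertex-edge: distinct edges meet only in common endpoints.
    edge-edge     : ∀ (e e′ : Edge G) →
      (src e , tgt e) ≢ (src e′ , tgt e′) →
      ∀ x → OnEdge e x → OnEdge e′ x → ∃[ w ] x ≡ pos w

  OnDrawing : Point → Set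
  OnDrawing x = (∃[ v ] x ≡ pos v) ⊎ (∃[ e ] OnEdge e x)

  FreeSegment : Rel Point 0ℓ
  FreeSegment p q = ∀ x → OnSegment p q x → ¬ OnDrawing x

  -- The face of a point p off the drawing is the set of points q with
  -- SameFace p q.
  SameFace : Rel Point 0ℓ
  SameFace = Star FreeSegment

  -- The outer face is the unbounded one.
  InOuterFace : Point → Set
  InOuterFace p =
      ¬ OnDrawing p
    × (∀ (R : ℚ) → ∃[ q ] SameFace p q × (R < ∣ proj₁ q ∣ ⊎ R < ∣ proj₂ q ∣))

  -- A vertex belongs to the outer face when it lies on its boundary, that is,
  -- in its closure (vertices themselves are never off the drawing).
  OnOuterFace : Vertex → Set
  OnOuterFace v =
    ∀ (ε : ℚ) → 0ℚ < ε → ∃[ p ] InOuterFace p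
      × ∣ proj₁ p - proj₁ (pos v) ∣ < ε
      × ∣ proj₂ p - proj₂ (pos v) ∣ < ε

Outerplanar : Graph → Set
Outerplanar G = Σ[ D ∈ PlanarDrawing G ] ∀ v → PlanarDrawing.OnOuterFace D v

{-# OPTIONS --safe #-}
module Submission where

-- In a (5/2,1)*-coloring the close edges, those whose colors have circular
-- distance 1, form a matching, and every triangle contains one of them, because
-- the pairs at distance 2 in ℤ/5 form a 5-cycle.  In two triangles h a b and
-- h b c the close edges cannot both avoid h, since they would share b.  A hub
-- joined to the path 1 … 6 carries two such pairs of triangles, on 1 2 3 and on
-- 4 5 6, hence would have two close neighbours.
--
-- To draw a graph without crossing edges, put its vertices on the parabola
-- y = x² and draw all edges as chords.  At abscissa x the chord from a to b has
-- height x² + (x - a)(b - x), so the drawing stays weakly above the parabola and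
-- the region below, which touches every vertex, belongs to the outer face.

open import Defs
open import Data.Product using (∃-syntax; _×_)
open import Relation.Nullary using (¬_)

open import Data.Fin as Fin using (Fin; zero; suc; toℕ; #_)
import Data.Fin.Properties as Fin
open import Data.List using (List; []; _∷_; length; allFin)
open import Data.List.Membership.Propositional using (_∈_; find)
open import Data.List.Membership.DecPropositional (Fin._≟_ {7}) using (_∈?_)
open import Data.List.Membership.Propositional.Properties using (∈-filter⁺; ∈-allFin)
open import Data.List.Relation.Unary.Any using (Any; here; there)
open import Data.Nat as ℕ using (ℕ; s≤s)
import Data.Nat.Properties as ℕ
open import Data.Product using (_,_; proj₁; proj₂)
open import Data.Rational
open import Data.Rational.Properties
open import Data.Rational.Solver using (module +-*-Solver)
open import Data.Sum using (_⊎_; inj₁; inj₂; [_,_]′; swap)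
open import Data.Unit using (tt)
open import Function using (_∘_)
open import Relation.Binary using (tri<; tri≈; tri>)
open import Relation.Binary.Construct.Closure.ReflexiveTransitive using (_◅_; ε)
open import Relation.Binary.PropositionalEquality
open import Relation.Nullary using (contradiction)
open import Relation.Nullary.Decidable using (¬?; True; _×-dec_; _⊎-dec_; _→-dec_; toWitness)

open import Algebra.Properties.Group +-0-group using (∙-cancelˡ)
open +-*-Solver using (solve; :-_; _:=_; _:+_; _:*_; _:-_; con)

-- Ordered arithmetic in ℚ

p≤q⇒0≤q-p : ∀ {p q} → p ≤ q → 0ℚ ≤ q - p
p≤q⇒0≤q-p {p} {q} p≤q = subst (_≤ q - p) (+-inverseʳ p) (+-monoˡ-≤ (- p) p≤q)

p<q⇒0<q-p : ∀ {p q} → p < q → 0ℚ < q - p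
p<q⇒0<q-p {p} {q} p<q = subst (_< q - p) (+-inverseʳ p) (+-monoˡ-< (- p) p<q)

0≤p∧0≤q⇒0≤p*q : ∀ {p q} → 0ℚ ≤ p → 0ℚ ≤ q → 0ℚ ≤ p * q
0≤p∧0≤q⇒0≤p*q {p} {q} 0≤p 0≤q =
  subst (_≤ p * q) (*-zeroʳ p) (*-monoˡ-≤-nonNeg p {{nonNegative 0≤p}} 0≤q)

0<p∧0<q⇒0<p*q : ∀ {p q} → 0ℚ < p → 0ℚ < q → 0ℚ < p * q
0<p∧0<q⇒0<p*q {p} {q} 0<p 0<q =
  subst (_< p * q) (*-zeroʳ p) (*-monoʳ-<-pos p {{positive 0<p}} 0<q)

≤⇒<∨≡ : ∀ {p q} → p ≤ q → p < q ⊎ p ≡ q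
≤⇒<∨≡ {p} {q} p≤q with <-cmp p q
... | tri< p<q _ _ = inj₁ p<q
... | tri≈ _ p≡q _ = inj₂ p≡q
... | tri> _ _ q<p = contradiction (≤-<-trans p≤q q<p) (<-irrefl refl)

p≤p+q : ∀ p {q} → 0ℚ ≤ q → p ≤ p + q
p≤p+q p 0≤q = subst (_≤ p + _) (+-identityʳ p) (+-monoʳ-≤ p 0≤q)

p<p+q : ∀ p {q} → 0ℚ < q → p < p + q
p<p+q p 0<q = subst (_< p + _) (+-identityʳ p) (+-monoʳ-< p 0<q)

p≤∣p∣ : ∀ p → p ≤ ∣ p ∣
p≤∣p∣ p with ≤-total 0ℚ p
... | inj₁ 0≤p = ≤-reflexive (sym (0≤p⇒∣p∣≡p 0≤p))
... | inj₂ p≤0 = ≤-trans p≤0 (0≤∣p∣ p)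

mix-const : ∀ t a → (1ℚ - t) * a + t * a ≡ a
mix-const = solve 2 (λ t a → (con 1ℚ :- t) :* a :+ t :* a := a) refl

mix-lower : ∀ {t a b} → 0ℚ ≤ t → a ≤ b → a ≤ (1ℚ - t) * a + t * b
mix-lower {t} {a} {b} 0≤t a≤b =
  subst (_≤ (1ℚ - t) * a + t * b) (mix-const t a)
    (+-monoʳ-≤ ((1ℚ - t) * a) (*-monoˡ-≤-nonNeg t {{nonNegative 0≤t}} a≤b))

mix-upper : ∀ {t a b} → t ≤ 1ℚ → a ≤ b → (1ℚ - t) * a + t * b ≤ b
mix-upper {t} {a} {b} t≤1 a≤b =
  subst ((1ℚ - t) * a + t * b ≤_) (mix-const t b)
    (+-monoˡ-≤ (t * b)
      (*-monoˡ-≤-nonNeg (1ℚ - t) {{nonNegative (p≤q⇒0≤q-p t≤1)}} a≤b))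

-- Chords of the parabola

parabola : ℚ → Point
parabola a = a , a * a

-- The segment with its parameter eliminated: two chords through one point can then be compared at
-- their common abscissa.
record OnChord (a b : ℚ) (p : Point) : Set where
  constructor onChord
  x = proj₁ p
  y = proj₂ p
  field
    lower  : a ≤ x
    upper  : x ≤ b
    height : y ≡ x * x + (x - a) * (b - x)

segment⇒chord : ∀ {a b p} → a ≤ b →
                OnSegment (parabola a) (parabola b) p → OnChord a b p
segment⇒chord {a} {b} a≤b (t , 0≤t , t≤1 , refl , refl) =
  onChord (mix-lower {t} 0≤t a≤b) (mix-upper {t} t≤1 a≤b)
    (solve 3 (λ t a b → let x = (con 1ℚ :- t) :* a :+ t :* b in
        (con 1ℚ :- t) :* (a :* a) :+ t :* (b :* b)
        := x :* x :+ (x :- a) :* (b :- x)) refl t a b)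

end-on-chord : ∀ {a b} → a ≤ b → OnChord a b (parabola b)
end-on-chord {a} {b} a≤b = onChord a≤b ≤-refl
  (solve 2 (λ a b → b :* b := b :* b :+ (b :- a) :* (b :- b)) refl a b)

chord-above : ∀ {a b x y} → OnChord a b (x , y) → x * x ≤ y
chord-above {x = x} (onChord a≤x x≤b refl) =
  p≤p+q (x * x) (0≤p∧0≤q⇒0≤p*q (p≤q⇒0≤q-p a≤x) (p≤q⇒0≤q-p x≤b))

chord-at-lower : ∀ {a b y} → OnChord a b (a , y) → (a , y) ≡ parabola a
chord-at-lower {a} {b} (onChord _ _ refl) = cong (a ,_)
  (solve 2 (λ a b → a :* a :+ (a :- a) :* (b :- a) := a :* a) refl a b)

chord-at-upper : ∀ {a b y} → OnChord a b (b , y) → (b , y) ≡ parabola b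
chord-at-upper {a} {b} (onChord _ _ refl) = cong (b ,_)
  (solve 2 (λ a b → b :* b :+ (b :- a) :* (b :- b) := b :* b) refl a b)

chord-strictly-above : ∀ {a b x y} → a < x → x < b → OnChord a b (x , y) → x * x < y
chord-strictly-above {x = x} a<x x<b (onChord _ _ refl) =
  p<p+q (x * x) (0<p∧0<q⇒0<p*q (p<q⇒0<q-p a<x) (p<q⇒0<q-p x<b))

chord-gap : ∀ a b c d x →
            x * x + (x - a) * (b - x) ≡ x * x + (x - c) * (d - x) →
            (x - a) * (b - d) + (c - a) * (d - x) ≡ 0ℚ
chord-gap a b c d x same = begin
  (x - a) * (b - d) + (c - a) * (d - x)
    ≡⟨ solve 5 (λ a b c d x →
         (x :- a) :* (b :- d) :+ (c :- a) :* (d :- x)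
         := (x :* x :+ (x :- a) :* (b :- x)) :- (x :* x :+ (x :- c) :* (d :- x)))
         refl a b c d x ⟩
  (x * x + (x - a) * (b - x)) - outer
    ≡⟨ cong (_- outer) same ⟩
  outer - outer
    ≡⟨ +-inverseʳ outer ⟩
  0ℚ ∎
  where
  open ≡-Reasoning
  outer = x * x + (x - c) * (d - x)

-- Subtracting the heights of the outer and the inner chord gives
-- (x - a) (b - d) + (c - a) (d - x), a sum of nonnegative terms.
nested-chords : ∀ {a b c d x y} → a ≤ c → d ≤ b → c < x → x < d →
                OnChord a b (x , y) → OnChord c d (x , y) → a ≡ c × d ≡ b
nested-chords {a} {b} {c} {d} {x} a≤c d≤b c<x x<d (onChord _ _ refl) (onChord _ _ same)
  with ≤⇒<∨≡ a≤c | ≤⇒<∨≡ d≤b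
... | inj₂ a≡c | inj₂ d≡b = a≡c , d≡b
-- Here the second product is strictly positive; in the next case the first one is. Either way the
-- sum cannot vanish.
... | inj₁ a<c | _ = contradiction gap≡0 (≢-sym (<⇒≢ (+-mono-≤-<
        (0≤p∧0≤q⇒0≤p*q (<⇒≤ (p<q⇒0<q-p (≤-<-trans a≤c c<x))) (p≤q⇒0≤q-p d≤b))
        (0<p∧0<q⇒0<p*q (p<q⇒0<q-p a<c) (p<q⇒0<q-p x<d)))))
  where gap≡0 = chord-gap a b c d x same
... | inj₂ _ | inj₁ d<b = contradiction gap≡0 (≢-sym (<⇒≢ (+-mono-<-≤
        (0<p∧0<q⇒0<p*q (p<q⇒0<q-p (≤-<-trans a≤c c<x)) (p<q⇒0<q-p d<b))
        (0≤p∧0≤q⇒0≤p*q (p≤q⇒0≤q-p a≤c) (<⇒≤ (p<q⇒0<q-p x<d))))))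
  where gap≡0 = chord-gap a b c d x same

chord-point : ∀ {a b p} → OnChord a b p →
                p ≡ parabola a ⊎ p ≡ parabola b ⊎ (a < proj₁ p × proj₁ p < b)
chord-point chord@(onChord a≤x x≤b _) with ≤⇒<∨≡ a≤x | ≤⇒<∨≡ x≤b
... | inj₂ refl | _         = inj₁ (chord-at-lower chord)
... | inj₁ _    | inj₂ refl = inj₂ (inj₁ (chord-at-upper chord))
... | inj₁ a<x  | inj₁ x<b  = inj₂ (inj₂ (a<x , x<b))

-- Noncrossing graphs are outerplanar

place : ∀ {n} → Fin n → ℚ
place zero    = 0ℚ
place (suc i) = 1ℚ + place i

0≤place : ∀ {n} (i : Fin n) → 0ℚ ≤ place i
0≤place zero    = ≤-refl
0≤place (suc i) = ≤-trans (0≤place i) (subst (place i ≤_) (+-comm (place i) 1ℚ)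
                    (p≤p+q (place i) (<⇒≤ (positive⁻¹ 1ℚ))))

place-mono-≤ : ∀ {n} {i j : Fin n} → i Fin.≤ j → place i ≤ place j
place-mono-≤ {i = zero}  {j}     _         = 0≤place j
place-mono-≤ {i = suc i} {suc j} (s≤s i≤j) = +-monoʳ-≤ 1ℚ (place-mono-≤ i≤j)

place-injective : ∀ {n} {i j : Fin n} → place i ≡ place j → i ≡ j
place-injective {i = zero}  {zero}  _  = refl
place-injective {i = zero}  {suc j} eq = contradiction eq
  (<⇒≢ (<-≤-trans (positive⁻¹ 1ℚ) (p≤p+q 1ℚ (0≤place j))))
place-injective {i = suc i} {zero}  eq = contradiction (sym eq)
  (<⇒≢ (<-≤-trans (positive⁻¹ 1ℚ) (p≤p+q 1ℚ (0≤place i))))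
place-injective {i = suc i} {suc j} eq =
  cong suc (place-injective (∙-cancelˡ 1ℚ (place i) (place j) eq))

module _ (G : Graph) where
  open Graph G using (Vertex; Adj)

  -- Chords of a convex curve cross exactly when their endpoints alternate. One alternating order
  -- suffices, as the two edges may be exchanged.
  Noncrossing : Set
  Noncrossing = ∀ {a b c d} → Adj a b → Adj c d →
                a Fin.< c → c Fin.< b → ¬ b Fin.< d

  module _ (noncrossing : Noncrossing) where

    point : Vertex → Point
    point = parabola ∘ place

    Chord : Vertex → Vertex → Point → Set
    Chord a b = OnChord (place a) (place b)

    point-injective : ∀ {i j} → point i ≡ point j → i ≡ j
    point-injective = place-injective ∘ cong proj₁

    -- The disjunction is what `OnEdge` unfolds to for a curve without bends: the segment, or the
    -- final point alone.
    onEdge⇒chord : ∀ {a b p} → a Fin.< b →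
                   OnSegment (point a) (point b) p ⊎ p ≡ point b → Chord a b p
    onEdge⇒chord a<b (inj₁ seg)  = segment⇒chord (place-mono-≤ (ℕ.<⇒≤ a<b)) seg
    onEdge⇒chord a<b (inj₂ refl) = end-on-chord (place-mono-≤ (ℕ.<⇒≤ a<b))

    -- By strict convexity, a chord touches the parabola only at its ends.
    vertex-on-chord : ∀ {w a b} → Chord a b (point w) → w ≡ a ⊎ w ≡ b
    vertex-on-chord chord with chord-point chord
    ... | inj₁ w≡a              = inj₁ (point-injective w≡a)
    ... | inj₂ (inj₁ w≡b)       = inj₂ (point-injective w≡b)
    ... | inj₂ (inj₂ (a<w , w<b)) =
      contradiction refl (<⇒≢ (chord-strictly-above a<w w<b chord))

    BeforeOrAround : (a b c d : Vertex) → Set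
    BeforeOrAround a b c d = b Fin.≤ c ⊎ (a Fin.≤ c × d Fin.≤ b)

    arrange : ∀ {a b c d} → Adj a b → Adj c d → a Fin.≤ c →
              BeforeOrAround a b c d ⊎ BeforeOrAround c d a b
    arrange {a} {b} {c} {d} ab cd a≤c with ℕ.<-≤-connex (toℕ c) (toℕ b)
    ... | inj₂ b≤c = inj₁ (inj₁ b≤c)
    ... | inj₁ c<b with ℕ.<-≤-connex (toℕ b) (toℕ d)
    ...   | inj₂ d≤b = inj₁ (inj₂ (a≤c , d≤b))
    ...   | inj₁ b<d with ℕ.m≤n⇒m<n∨m≡n a≤c
    ...     | inj₁ a<c = contradiction b<d (noncrossing ab cd a<c c<b)
    -- With a shared left end and `b < d`, the second edge goes around the first.
    ...     | inj₂ a≡c = inj₂ (inj₂ (ℕ.≤-reflexive (sym a≡c) , ℕ.<⇒≤ b<d))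

    chords-meet : ∀ {a b c d p} → BeforeOrAround a b c d → (a , b) ≢ (c , d) →
                  Chord a b p → Chord c d p → ∃[ w ] p ≡ point w
    chords-meet {b = b} {c} (inj₁ b≤c) _ ab@(onChord _ x≤b _) (onChord c≤x _ _)
      -- The abscissa is at most `place b` and at least `place c`, hence equal to `place b`.
      with refl ← ≤-antisym x≤b (≤-trans (place-mono-≤ b≤c) c≤x) = b , chord-at-upper ab
    chords-meet {c = c} {d} (inj₂ (a≤c , d≤b)) differ ab cd with chord-point cd
    ... | inj₁ p≡c              = c , p≡c
    ... | inj₂ (inj₁ p≡d)       = d , p≡d
    ... | inj₂ (inj₂ (c<x , x<d))
      with a≡c , d≡b ← nested-chords (place-mono-≤ a≤c) (place-mono-≤ d≤b) c<x x<d ab cd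
      = contradiction (cong₂ _,_ (place-injective a≡c) (sym (place-injective d≡b))) differ

    drawing : PlanarDrawing G
    drawing = record
      { pos           = point
      ; bends         = λ _ _ → []
      ; pos-injective = point-injective
      ; edge-simple   = λ { (edge a b a<b _) →
          -- After its only segment the curve is reduced to its endpoint, so lying on that remainder
          -- already means being the corner.
          (λ a≡b → Fin.<⇒≢ a<b (point-injective a≡b)) , (λ _ _ x≡b → x≡b) , tt }
      ; vertex-edge   = λ { w (edge a b a<b _) on → vertex-on-chord (onEdge⇒chord a<b on) }
      ; edge-edge     = λ { (edge a b a<b ab) (edge c d c<d cd) differ x on on′ →
          meet ab cd differ (onEdge⇒chord a<b on) (onEdge⇒chord c<d on′) }
      }
      where
      meet : ∀ {a b c d p} → Adj a b → Adj c d → (a , b) ≢ (c , d) →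
             Chord a b p → Chord c d p → ∃[ w ] p ≡ point w
      meet {a} {c = c} ab cd differ on on′
        with [ arrange ab cd , swap ∘ arrange cd ab ]′ (Fin.≤-total a c)
      ... | inj₁ position = chords-meet position differ on on′
      ... | inj₂ position = chords-meet position (≢-sym differ) on′ on

    open PlanarDrawing drawing using (OnDrawing; InOuterFace; OnOuterFace)

    drawing-above : ∀ {x y} → OnDrawing (x , y) → x * x ≤ y
    drawing-above (inj₁ (_ , refl))             = ≤-refl
    drawing-above (inj₂ (edge _ _ a<b _ , on)) = chord-above (onEdge⇒chord a<b on)

    -- A vertical segment pointing down never leaves the region below the parabola and can be made
    -- arbitrarily long.
    below⇒outer : ∀ {x y} → y < x * x → InOuterFace (x , y)
    below⇒outer {x} {y} y<x² = below y<x² , λ R →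
      -- The minimum puts `q` below `y` and low enough; the summand 1 makes `R < ∣ q ∣` strict.
      let q = y ⊓ - (R + 1ℚ) in
      (x , q) , descend (p⊓q≤p y (- (R + 1ℚ))) ◅ ε , inj₂ (far R q (p⊓q≤q y (- (R + 1ℚ))))
      where
      below : ∀ {x y} → y < x * x → ¬ OnDrawing (x , y)
      below y<x² on = <-irrefl refl (≤-<-trans (drawing-above on) y<x²)

      descend : ∀ {q} → q ≤ y → PlanarDrawing.FreeSegment drawing (x , y) (x , q)
      descend {q} q≤y _ (t , 0≤t , _ , refl , refl) = below (subst
        (λ z → (1ℚ - t) * y + t * q < z * z) (sym (mix-const t x))
        (≤-<-trans (≤-trans
          (+-monoʳ-≤ ((1ℚ - t) * y) (*-monoˡ-≤-nonNeg t {{nonNegative 0≤t}} q≤y))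
          (≤-reflexive (mix-const t y))) y<x²))

      far : ∀ R q → q ≤ - (R + 1ℚ) → R < ∣ q ∣
      far R q q≤ = begin-strict
        R              <⟨ p<p+q R (positive⁻¹ 1ℚ) ⟩
        R + 1ℚ         ≡⟨ solve 1 (λ p → p := :- (:- p)) refl (R + 1ℚ) ⟩
        - - (R + 1ℚ)   ≤⟨ neg-antimono-≤ q≤ ⟩
        - q            ≤⟨ p≤∣p∣ (- q) ⟩
        ∣ - q ∣        ≡⟨ ∣-p∣≡∣p∣ q ⟩
        ∣ q ∣          ∎
        where open ≤-Reasoning

    all-outer : ∀ v → OnOuterFace v
    all-outer v r 0<r = (x , x * x - δ) , below⇒outer x²-δ<x² ,
      subst (_< r) (sym (cong ∣_∣ (+-inverseʳ x))) 0<r ,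
      subst (_< r) (sym ∣height∣≡δ) δ<r
      where
      x = place v
      -- Moving straight down by some `δ` strictly between 0 and `r` keeps the abscissa and stays
      -- within the tolerance.
      δ = proj₁ (<-dense 0<r)
      0<δ = proj₁ (proj₂ (<-dense 0<r))
      δ<r = proj₂ (proj₂ (<-dense 0<r))

      x²-δ<x² : x * x - δ < x * x
      x²-δ<x² = subst (x * x - δ <_) (+-identityʳ (x * x))
                  (+-monoʳ-< (x * x) (neg-antimono-< 0<δ))

      ∣height∣≡δ : ∣ (x * x - δ) - x * x ∣ ≡ δ
      ∣height∣≡δ = begin
        ∣ (x * x - δ) - x * x ∣ ≡⟨ cong ∣_∣ (solve 2 (λ h δ → (h :- δ) :- h := :- δ) refl (x * x) δ) ⟩
        ∣ - δ ∣                 ≡⟨ ∣-p∣≡∣p∣ δ ⟩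
        ∣ δ ∣                   ≡⟨ 0≤p⇒∣p∣≡p (<⇒≤ 0<δ) ⟩
        δ                       ∎
        where open ≡-Reasoning

    noncrossing⇒outerplanar : Outerplanar G
    noncrossing⇒outerplanar = drawing , all-outer

-- Close edges

circularDistance-sym : ∀ {k} (i j : Fin k) → circularDistance i j ≡ circularDistance j i
circularDistance-sym {k} i j =
  cong (λ d → d ℕ.⊓ (k ℕ.∸ d)) (ℕ.∣-∣-comm (toℕ i) (toℕ j))

length≤1⇒unique : ∀ {A : Set} {xs : List A} {x y} → length xs ℕ.≤ 1 → x ∈ xs → y ∈ xs → x ≡ y
length≤1⇒unique {xs = _ ∷ []}    _         (here refl) (here refl) = refl
length≤1⇒unique {xs = _ ∷ _ ∷ _} (s≤s ())

-- Otherwise the three colors would form a triangle in the 5-cycle of pairs at distance 2. The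
-- finitely many triples are checked by evaluation.
close-pair : (i j k : Fin 5) → i ≢ j → i ≢ k → j ≢ k →
             circularDistance i j ≡ 1 ⊎ circularDistance i k ≡ 1 ⊎ circularDistance j k ≡ 1
close-pair = toWitness {a? = Fin.all? λ i → Fin.all? λ j → Fin.all? λ k →
  ¬? (i Fin.≟ j) →-dec ¬? (i Fin.≟ k) →-dec ¬? (j Fin.≟ k) →-dec
  ((circularDistance i j ℕ.≟ 1) ⊎-dec (circularDistance i k ℕ.≟ 1)
    ⊎-dec (circularDistance j k ℕ.≟ 1))} tt

module CloseEdges (G : Graph) {f : Graph.Vertex G → Fin 5} (coloring : IsColoring G 5 1 f) where
  open Graph G using (Vertex; Adj) renaming (sym to Adj-sym)
  open IsColoring coloring

  Close : Vertex → Vertex → Set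
  Close u v = Adj u v × circularDistance (f u) (f v) ≡ 1

  Close-sym : ∀ {u v} → Close u v → Close v u
  Close-sym {u} {v} (uv , d) = Adj-sym uv , trans (circularDistance-sym (f v) (f u)) d

  Close-unique : ∀ {u v w} → Close u v → Close u w → v ≡ w
  Close-unique {u} uv uw = length≤1⇒unique (defective u) (member uv) (member uw)
    where
    member : ∀ {v} → Close u v → v ∈ closeNeighbours G f u
    member = ∈-filter⁺ _ (∈-allFin _)

  triangle : ∀ {u v w} → Adj u v → Adj u w → Adj v w →
             Close u v ⊎ Close u w ⊎ Close v w
  triangle {u} {v} {w} uv uw vw
    with close-pair (f u) (f v) (f w) (proper uv) (proper uw) (proper vw)
  ... | inj₁ d        = inj₁ (uv , d)
  ... | inj₂ (inj₁ d) = inj₂ (inj₁ (uw , d))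
  ... | inj₂ (inj₂ d) = inj₂ (inj₂ (vw , d))

  diamond : ∀ {h a b c} → Adj h a → Adj h b → Adj h c → Adj a b → Adj b c → a ≢ c →
            Any (Close h) (a ∷ b ∷ c ∷ [])
  diamond ha hb hc ab bc a≢c with triangle ha hb ab | triangle hb hc bc
  ... | inj₁ a         | _              = here a
  ... | inj₂ (inj₁ b)  | _              = there (here b)
  ... | _              | inj₁ b         = there (here b)
  ... | _              | inj₂ (inj₁ c)  = there (there (here c))
  -- Both close edges avoid `h`, so `a` and `c` are close neighbours of `b` and must coincide.
  ... | inj₂ (inj₂ ab) | inj₂ (inj₂ bc) =
    contradiction (Close-unique (Close-sym ab) bc) a≢c

-- Fans

-- Vertex 0 is the hub and the others form a path in their order; `i ≢ j` rules out a loop at the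
-- hub.
fan : ℕ → Graph
fan n = record
  { order  = n
  ; Adj    = λ i j → i ≢ j × (toℕ i ≡ 0 ⊎ toℕ j ≡ 0 ⊎ ℕ.∣ toℕ i - toℕ j ∣ ≡ 1)
  ; adj?   = λ i j → ¬? (i Fin.≟ j) ×-dec
               ((toℕ i ℕ.≟ 0) ⊎-dec (toℕ j ℕ.≟ 0) ⊎-dec (ℕ.∣ toℕ i - toℕ j ∣ ℕ.≟ 1))
  ; sym    = λ { {i} {j} (i≢j , c) → ≢-sym i≢j , flip i j c }
  ; irrefl = λ { refl (i≢i , _) → i≢i refl }
  }
  where
  flip : ∀ i j → toℕ i ≡ 0 ⊎ toℕ j ≡ 0 ⊎ ℕ.∣ toℕ i - toℕ j ∣ ≡ 1 →
                 toℕ j ≡ 0 ⊎ toℕ i ≡ 0 ⊎ ℕ.∣ toℕ j - toℕ i ∣ ≡ 1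
  flip i j (inj₁ i≡0)        = inj₂ (inj₁ i≡0)
  flip i j (inj₂ (inj₁ j≡0)) = inj₁ j≡0
  flip i j (inj₂ (inj₂ d))   = inj₂ (inj₂ (trans (ℕ.∣-∣-comm (toℕ j) (toℕ i)) d))

-- Both `c` and `d` exceed another vertex, so neither is the hub and `c d` is a path edge; but `b`
-- lies strictly between these consecutive numbers.
fan-noncrossing : ∀ n → Noncrossing (fan n)
fan-noncrossing n {a} {b} {c} {d} _ (_ , cd) a<c c<b b<d with cd
... | inj₁ c≡0        = ℕ.n≮0 (subst (toℕ a ℕ.<_) c≡0 a<c)
... | inj₂ (inj₁ d≡0) = ℕ.n≮0 (subst (toℕ b ℕ.<_) d≡0 b<d)
... | inj₂ (inj₂ gap) = ℕ.<-irrefl (sym gap) (begin-strict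
  1                        ≤⟨ ℕ.m<n⇒0<n∸m c<b ⟩
  toℕ b ℕ.∸ toℕ c          <⟨ ℕ.∸-monoˡ-< b<d (ℕ.<⇒≤ c<b) ⟩
  toℕ d ℕ.∸ toℕ c          ≡⟨ ℕ.m≤n⇒∣m-n∣≡n∸m (ℕ.<⇒≤ (ℕ.<-trans c<b b<d)) ⟨
  ℕ.∣ toℕ c - toℕ d ∣      ∎)
  where open ℕ.≤-Reasoning

fan-uncolorable : ¬ Colorable (fan 7) 5 1
fan-uncolorable (f , coloring) =
  let v , v∈ , 0v = find (hub (# 1) (# 2) (# 3) λ ())
      w , w∈ , 0w = find (hub (# 4) (# 5) (# 6) λ ())
  -- The hub has only one close neighbour, so `v` and `w` agree, although they come from disjoint
  -- parts of the path.
  in disjoint v (v∈ , subst (_∈ _) (Close-unique 0w 0v) w∈)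
  where
  open Graph (fan 7) using (adj?)
  open CloseEdges (fan 7) coloring

  -- The implicit `True` arguments are solved by evaluating `adj?` at concrete vertices, so no
  -- adjacency proof has to be written.
  hub : ∀ a b c {_ : True (adj? (# 0) a)} {_ : True (adj? (# 0) b)} {_ : True (adj? (# 0) c)}
        {_ : True (adj? a b)} {_ : True (adj? b c)} → a ≢ c → Any (Close (# 0)) (a ∷ b ∷ c ∷ [])
  hub a b c {p} {q} {r} {s} {t} =
    diamond (toWitness p) (toWitness q) (toWitness r) (toWitness s) (toWitness t)

  disjoint : ∀ v → ¬ (v ∈ # 1 ∷ # 2 ∷ # 3 ∷ [] × v ∈ # 4 ∷ # 5 ∷ # 6 ∷ [])
  disjoint = toWitness {a? = Fin.all? λ v → ¬? ((v ∈? _) ×-dec (v ∈? _))} tt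

theorem5p2 : ∃[ G ] (Outerplanar G × ¬ Colorable G 5 1)
theorem5p2 = fan 7 , noncrossing⇒outerplanar (fan 7) (fan-noncrossing 7) , fan-uncolorable
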